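{- Let $ST$ be an oriented star of degree at least $4$. Then no digraph $H$ such that $\{H, ST\}$ is $\vec{\chi}$-finite contains the in-triangle $IT$ as a subgraph.
   Context: All digraphs are finite, loopless, and between any two distinct vertices at most one of the two possible arcs is present. A digraph is $\mathcal{F}$-free if it has no induced subdigraph isomorphic to a member of $\mathcal{F}$. The dichromatic number $\vec{\chi}(D)$ is the least $k$ such that $V(D)$ can be partitioned into $k$ sets each inducing an acyclic subdigraph. A finite family $\mathcal{F}$ is $\vec{\chi}$-finite if there is $c$ such that every $\mathcal{F}$-free digraph has dichromatic number at most $c$ (such $H$ are called heroes in $ST$-free digraphs). An oriented star of degree $t$ is an orientation of $K_{1,t}$. The in-triangle $IT$ is the digraph on vertices $a,b,c,d$ with arcs $ab, bc, ca, ad, bd, cd$. -}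

module Defs where

open import Data.Nat using (ℕ; zero; suc; _≤_)
open import Data.Fin using (Fin; zero; suc; inject₁; fromℕ)
open import Data.Bool using (Bool; true; false; not)
open import Data.Product using (Σ; ∃; _×_; _,_)
open import Data.Empty using (⊥)
open import Relation.Nullary using (¬_)
open import Relation.Binary.PropositionalEquality using (_≡_)
open import Function.Definitions using (Injective)

record Digraph : Set where
  field
    n     : ℕ
    arc   : Fin n → Fin n → Bool
    loopless : ∀ v → arc v v ≡ false
    antisym  : ∀ u v → arc u v ≡ true → arc v u ≡ false
open Digraph public

InducedIn : Digraph → Digraph → Set
InducedIn F D = Σ (Fin (n F) → Fin (n D)) λ f →
  Injective _≡_ _≡_ f × (∀ u v → arc D (f u) (f v) ≡ arc F u v)

SubgraphIn : Digraph → Digraph → Set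
SubgraphIn F D = Σ (Fin (n F) → Fin (n D)) λ f →
  Injective _≡_ _≡_ f × (∀ u v → arc F u v ≡ true → arc D (f u) (f v) ≡ true)

Acyclic : (D : Digraph) → (Fin (n D) → Set) → Set
Acyclic D S = ∀ (m : ℕ) → 1 ≤ m → (f : Fin (suc m) → Fin (n D)) →
  Injective _≡_ _≡_ f →
  (∀ i → S (f i)) →
  (∀ (i : Fin m) → arc D (f (inject₁ i)) (f (suc i)) ≡ true) →
  ¬ (arc D (f (fromℕ m)) (f zero) ≡ true)

DichromaticAtMost : Digraph → ℕ → Set
DichromaticAtMost D k = Σ (Fin (n D) → Fin k) λ c →
  ∀ (j : Fin k) → Acyclic D (λ v → c v ≡ j)

ChiFinite₂ : Digraph → Digraph → Set
ChiFinite₂ H S = ∃ λ (c : ℕ) → ∀ (D : Digraph) →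
  ¬ InducedIn H D → ¬ InducedIn S D → DichromaticAtMost D c

starArc : (t : ℕ) → (Fin t → Bool) → Fin (suc t) → Fin (suc t) → Bool
starArc t dir zero    zero    = false
starArc t dir zero    (suc i) = dir i
starArc t dir (suc i) zero    = not (dir i)
starArc t dir (suc i) (suc j) = false

private
  starLoop : ∀ t dir v → starArc t dir v v ≡ false
  starLoop t dir zero = _≡_.refl
  starLoop t dir (suc v) = _≡_.refl

  starAnti : ∀ t dir u v → starArc t dir u v ≡ true → starArc t dir v u ≡ false
  starAnti t dir zero zero ()
  starAnti t dir zero (suc i) p with dir i
  ... | true = _≡_.refl
  starAnti t dir (suc i) zero p with dir i
  starAnti t dir (suc i) zero () | true
  ... | false = _≡_.refl
  starAnti t dir (suc i) (suc j) ()

OrientedStar : (t : ℕ) → (Fin t → Bool) → Digraph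
OrientedStar t dir = record
  { n = suc t ; arc = starArc t dir ; loopless = starLoop t dir ; antisym = starAnti t dir }

itArc : Fin 4 → Fin 4 → Bool
itArc zero (suc zero) = true
itArc (suc zero) (suc (suc zero)) = true
itArc (suc (suc zero)) zero = true
itArc zero (suc (suc (suc zero))) = true
itArc (suc zero) (suc (suc (suc zero))) = true
itArc (suc (suc zero)) (suc (suc (suc zero))) = true
itArc _ _ = false

private
  itLoop : ∀ v → itArc v v ≡ false
  itLoop zero = _≡_.refl
  itLoop (suc zero) = _≡_.refl
  itLoop (suc (suc zero)) = _≡_.refl
  itLoop (suc (suc (suc zero))) = _≡_.refl

  itAnti : ∀ u v → itArc u v ≡ true → itArc v u ≡ false
  itAnti zero (suc zero) _ = _≡_.refl
  itAnti (suc zero) (suc (suc zero)) _ = _≡_.refl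
  itAnti (suc (suc zero)) zero _ = _≡_.refl
  itAnti zero (suc (suc (suc zero))) _ = _≡_.refl
  itAnti (suc zero) (suc (suc (suc zero))) _ = _≡_.refl
  itAnti (suc (suc zero)) (suc (suc (suc zero))) _ = _≡_.refl
  itAnti zero zero ()
  itAnti zero (suc (suc zero)) ()
  itAnti (suc zero) zero ()
  itAnti (suc zero) (suc zero) ()
  itAnti (suc (suc zero)) (suc zero) ()
  itAnti (suc (suc zero)) (suc (suc zero)) ()
  itAnti (suc (suc (suc zero))) _ ()

IT : Digraph
IT = record { n = 4 ; arc = itArc ; loopless = itLoop ; antisym = itAnti }

-- Take the line graph of the complete graph on 0, …, n − 1 and orient it by
-- ab → bc → ac → ab for a < b < c. The edges at a common endpoint then form a
-- transitive tournament: those arriving from below come first, by decreasing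
-- lower end, followed by those leaving upwards, by decreasing upper end. Four
-- pairwise adjacent edges share an endpoint, so no cyclic triangle dominates a
-- vertex. The neighbourhood of an edge is covered by two tournaments, so there
-- is not even an induced star of degree 3. A colouring of the edges with few
-- colours has, by Ramsey's theorem, a monochromatic triangle a < b < c, which
-- is a directed cycle.
module Submission where

open import Defs
open import Data.Nat as ℕ using (ℕ; zero; suc; _+_; _*_; _≤_; s≤s; z≤n)
import Data.Nat.Properties as ℕ
open import Data.Fin using (Fin; zero; suc; toℕ; _<_; _≟_; punchOut; combine; remQuot; inject≤; inject₁)
open import Data.Fin.Patterns using (0F; 1F; 2F; 3F)
open import Data.Fin.Properties
  using (<-trans; <-irrefl; <-asym; <-cmp; _<?_; suc-injective; punchOut-injective; punchIn-punchOut;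
         remQuot-combine; combine-remQuot; inject≤-injective)
open import Data.Bool using (Bool; true; false; not)
open import Data.Product using (Σ; ∃; _×_; _,_; uncurry)
open import Data.Sum using (_⊎_; inj₁; inj₂; [_,_]′)
open import Data.Empty using (⊥; ⊥-elim)
open import Function using (_∘_)
open import Function.Definitions using (Injective)
open import Level using (0ℓ)
open import Relation.Nullary using (¬_; Dec; yes; no; does; contradiction)
open import Relation.Nullary.Decidable using (_×-dec_; _⊎-dec_; dec-true; dec-false)
open import Relation.Unary using (Pred; Decidable; ∁)
open import Relation.Binary.Definitions using (tri<; tri≈; tri>)
open import Relation.Binary.PropositionalEquality
  using (_≡_; _≢_; refl; sym; trans; cong; subst₂)

-- Ramsey's theorem for triangles

StrictlyMonotone : ∀ {m n} → (Fin m → Fin n) → Set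
StrictlyMonotone g = ∀ {i j} → i < j → g i < g j

MonotoneInto : ∀ {n} → ℕ → Pred (Fin n) 0ℓ → Set
MonotoneInto {n} m P = Σ (Fin m → Fin n) λ g → StrictlyMonotone g × (∀ i → P (g i))

empty : ∀ {n} {P : Pred (Fin n) 0ℓ} → MonotoneInto 0 P
empty = (λ ()) , (λ { {()} }) , λ ()

shift : ∀ {m n} {P : Pred (Fin (suc n)) 0ℓ} → MonotoneInto m (P ∘ suc) → MonotoneInto m P
shift (g , mono , Pg) = suc ∘ g , s≤s ∘ mono , Pg

extend : ∀ {m n} {P : Pred (Fin (suc n)) 0ℓ} →
         P zero → MonotoneInto m (P ∘ suc) → MonotoneInto (suc m) P
extend {m} {n} {P} P0 (g , mono , Pg) = h , h-mono , Ph
  where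
  h : Fin (suc m) → Fin (suc n)
  h zero    = zero
  h (suc i) = suc (g i)

  h-mono : StrictlyMonotone h
  h-mono {zero}  {suc j} _       = s≤s z≤n
  h-mono {suc i} {suc j} (s≤s p) = s≤s (mono p)

  Ph : ∀ i → P (h i)
  Ph zero    = P0
  Ph (suc i) = Pg i

-- Position `zero` lengthens one of the two subsequences, as decided by `P? zero`, and the induction
-- continues on the later positions with the target of that one lowered by one.
dichotomy : ∀ {n} a b → a + b ≤ n → {P : Pred (Fin n) 0ℓ} → Decidable P →
            MonotoneInto a P ⊎ MonotoneInto b (∁ P)
dichotomy zero    b       _       {P} P? = inj₁ (empty {P = P})
dichotomy (suc a) zero    _       {P} P? = inj₂ (empty {P = ∁ P})
dichotomy (suc a) (suc b) (s≤s h) {P} P? with P? zero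
... | yes P0 = [ inj₁ ∘ extend {P = P} P0 , inj₂ ∘ shift {P = ∁ P} ]′
                 (dichotomy a (suc b) h (P? ∘ suc))
... | no ¬P0 = [ inj₁ ∘ shift {P = P} , inj₂ ∘ extend {P = ∁ P} ¬P0 ]′
                 (dichotomy (suc a) b (ℕ.≤-trans (ℕ.≤-reflexive (sym (ℕ.+-suc a b))) h) (P? ∘ suc))

-- Colours are removed one at a time: either colour `zero` occurs `m` times, or `suc (k * m)`
-- positions avoid it and `punchOut` recolours them with `k` colours.
pigeonhole-monotone : ∀ k m (f : Fin (suc (k * m)) → Fin k) →
                      ∃ λ c → MonotoneInto m λ i → c ≡ f i
pigeonhole-monotone zero    m f = contradiction (f zero) λ ()
pigeonhole-monotone (suc k) m f
  with dichotomy m (suc (k * m)) (ℕ.≤-reflexive (ℕ.+-suc m (k * m))) (λ i → zero ≟ f i)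
... | inj₁ hits = zero , hits
... | inj₂ (g , g-mono , misses)
  with pigeonhole-monotone k m (λ i → punchOut (misses i))
... | c , h , h-mono , hits =
  suc c , g ∘ h , g-mono ∘ h-mono ,
  λ i → trans (cong suc (hits i)) (punchIn-punchOut (misses (h i)))

EdgeColouring : ℕ → ℕ → Set
EdgeColouring n k = {i j : Fin n} → i < j → Fin k

-- The three proofs of `<` are independent arguments, so a colouring pulled back along a monotone
-- map inherits the property without any comparison of proofs.
NoMonochromaticTriangle : ∀ {n k} → EdgeColouring n k → Set
NoMonochromaticTriangle {n} χ = {i j l : Fin n} (p : i < j) (q : j < l) (r : i < l) →
  χ p ≡ χ q → ¬ χ q ≡ χ r

-- Induction on `k`. Many edges at vertex `zero` share a colour `c`. An edge of colour `c` between
-- their other ends would close a monochromatic triangle, so these ends are joined by edges of only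
-- `k` colours.
ramsey : ∀ k → ∃ λ n → (χ : EdgeColouring n k) → ¬ NoMonochromaticTriangle χ
ramsey zero    = 2 , λ χ _ → contradiction (χ {zero} {suc zero} (s≤s z≤n)) λ ()
ramsey (suc k) with ramsey k
-- Vertex `zero` and `suc (suc k * m)` further vertices, enough for `m` edges of one colour at
-- `zero`.
... | m , impossible = suc (suc (suc k * m)) , no-colouring
  where
  no-colouring : (χ : EdgeColouring _ (suc k)) → ¬ NoMonochromaticTriangle χ
  no-colouring χ noTriangle
    with pigeonhole-monotone (suc k) m (λ j → χ {zero} {suc j} (s≤s z≤n))
  ... | c , g , g-mono , hits =
    impossible (λ p → punchOut (avoids p)) λ p q r e₁ e₂ →
      noTriangle (lift p) (lift q) (lift r)
        (punchOut-injective (avoids p) (avoids q) e₁)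
        (punchOut-injective (avoids q) (avoids r) e₂)
    where
    lift : ∀ {i j} → i < j → suc (g i) < suc (g j)
    lift p = s≤s (g-mono p)

    avoids : ∀ {i j} (p : i < j) → c ≢ χ (lift p)
    avoids {i} {j} p c≡ =
      noTriangle (s≤s z≤n) (lift p) (s≤s z≤n)
        (trans (sym (hits i)) c≡) (trans (sym c≡) (hits j))

-- The oriented line graph of the complete graph

Pair : ℕ → Set
Pair n = Fin n × Fin n

infix 4 _⟶_

-- In a triangle a < b < c the three alternatives are, in this order, ab → bc, ac → ab and bc → ac.
_⟶_ : ∀ {n} → Pair n → Pair n → Set
(a , b) ⟶ (c , d) = a < b × c < d × (b ≡ c ⊎ (a ≡ c × d < b) ⊎ (b ≡ d × c < a))

pattern consecutive p q   = p , q , inj₁ refl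
pattern sameLower   p q r = p , q , inj₂ (inj₁ (refl , r))
pattern sameUpper   p q r = p , q , inj₂ (inj₂ (refl , r))

_⟶?_ : ∀ {n} (P Q : Pair n) → Dec (P ⟶ Q)
(a , b) ⟶? (c , d) =
  a <? b ×-dec c <? d ×-dec (b ≟ c ⊎-dec (a ≟ c ×-dec d <? b) ⊎-dec (b ≟ d ×-dec c <? a))

<-irr : ∀ {n} {i : Fin n} → ¬ i < i
<-irr = <-irrefl refl

⟶-asym : ∀ {n} {P Q : Pair n} → P ⟶ Q → ¬ Q ⟶ P
⟶-asym (consecutive p q)   (consecutive _ _)   = <-asym p q
⟶-asym (consecutive p _)   (sameLower _ _ _)   = <-irr p
⟶-asym (consecutive _ q)   (sameUpper _ _ _)   = <-irr q
⟶-asym (sameLower _ q _)   (consecutive _ _)   = <-irr q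
⟶-asym (sameLower _ _ r)   (sameLower _ _ s)   = <-asym r s
⟶-asym (sameLower _ _ r)   (sameUpper _ _ _)   = <-irr r
⟶-asym (sameUpper p _ _)   (consecutive _ _)   = <-irr p
⟶-asym (sameUpper _ _ r)   (sameLower _ _ _)   = <-irr r
⟶-asym (sameUpper _ _ r)   (sameUpper _ _ s)   = <-asym r s

⟶-cyclic : ∀ {n} {i j l : Fin n} → i < j → j < l →
  ((i , j) ⟶ (j , l)) × ((j , l) ⟶ (i , l)) × ((i , l) ⟶ (i , j))
⟶-cyclic p q =
  consecutive p q , sameUpper q (<-trans p q) p , sameLower (<-trans p q) p q

-- Cyclic triangles and domination

Dominated : ∀ {n} → Pair n → Pair n → Pair n → Set
Dominated {n} P Q R = ∃ λ (S : Pair n) → (P ⟶ S) × (Q ⟶ S) × (R ⟶ S)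

-- The only cyclic triangles are ab → bd → ad → ab with a < b < d.
third-side : ∀ {n} {a b d : Fin n} {R : Pair n} →
  a < b → b < d → (b , d) ⟶ R → R ⟶ (a , b) → R ≡ (a , d)
third-side a<b b<d (consecutive _ d<f) (consecutive _ _)    = ⊥-elim (<-irr (<-trans a<b (<-trans b<d d<f)))
third-side a<b b<d (consecutive _ d<f) (sameLower _ _ _)    = ⊥-elim (<-asym a<b b<d)
third-side a<b b<d (consecutive _ d<f) (sameUpper _ _ _)    = ⊥-elim (<-asym b<d d<f)
third-side a<b b<d (sameLower _ b<f _) (consecutive _ _)    = ⊥-elim (<-asym a<b b<f)
third-side a<b b<d (sameLower _ b<f _) (sameLower _ _ _)    = ⊥-elim (<-irr a<b)
third-side a<b b<d (sameLower _ b<f _) (sameUpper _ _ _)    = ⊥-elim (<-irr b<f)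
third-side a<b b<d (sameUpper _ _ _)   (consecutive _ _)    = ⊥-elim (<-asym a<b b<d)
third-side a<b b<d (sameUpper _ _ _)   (sameLower _ _ _)    = refl
third-side a<b b<d (sameUpper _ _ _)   (sameUpper _ _ _)    = ⊥-elim (<-irr b<d)

-- A pair that meets all three sides of the triangle `a`, `b`, `d` contains two of its corners, so
-- it is itself a side, and no side has an arc to itself.
not-dominated : ∀ {n} {a b d : Fin n} → a < b → b < d → ¬ Dominated (a , b) (b , d) (a , d)
not-dominated a<b b<d (_ , consecutive _ _   , consecutive _ _   , _)                  = <-irr b<d
not-dominated a<b b<d (_ , consecutive _ _   , sameLower _ _ f<d , consecutive _ _)    = <-irr b<d
not-dominated a<b b<d (_ , consecutive _ _   , sameLower _ _ f<d , sameLower _ _ _)    = <-irr a<b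
not-dominated a<b b<d (_ , consecutive _ _   , sameLower _ _ f<d , sameUpper _ _ _)    = <-irr f<d
not-dominated a<b b<d (_ , consecutive _ _   , sameUpper _ _ r   , _)                  = <-irr r
not-dominated a<b b<d (_ , sameLower _ _ _   , consecutive _ _   , _)                  = <-asym a<b b<d
not-dominated a<b b<d (_ , sameLower _ _ _   , sameLower _ _ _   , _)                  = <-irr a<b
not-dominated a<b b<d (_ , sameLower _ _ f<b , sameUpper _ _ _   , _)                  = <-asym b<d f<b
not-dominated a<b b<d (_ , sameUpper _ _ e<a , consecutive _ _   , _)                  = <-asym a<b (<-trans b<d e<a)
not-dominated a<b b<d (_ , sameUpper _ _ e<a , sameLower _ _ _   , _)                  = <-asym a<b e<a
not-dominated a<b b<d (_ , sameUpper _ _ _   , sameUpper _ _ _   , _)                  = <-irr b<d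

consecutive-not-dominated : ∀ {n} {a b d : Fin n} {R : Pair n} → a < b → b < d →
  (b , d) ⟶ R → R ⟶ (a , b) → ¬ Dominated (a , b) (b , d) R
consecutive-not-dominated a<b b<d QR RP dom with third-side a<b b<d QR RP
... | refl = not-dominated a<b b<d dom

-- Arcs of the kinds `sameLower` and `sameUpper` strictly decrease this sum, so every directed cycle
-- has a `consecutive` arc.
weight : ∀ {n} → Pair n → ℕ
weight (a , b) = toℕ a + toℕ b

-- The triangle is rotated, together with its arcs to `S`, until it starts with a `consecutive` arc;
-- if there is none, `weight` decreases all the way round.
cyclic-not-dominated : ∀ {n} {P Q R : Pair n} → P ⟶ Q → Q ⟶ R → R ⟶ P → ¬ Dominated P Q R
cyclic-not-dominated (consecutive p q) QR RP dom = consecutive-not-dominated p q QR RP dom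
cyclic-not-dominated PQ@(_ , _ , inj₂ _) (consecutive p q) RP (S , PS , QS , RS) =
  consecutive-not-dominated p q RP PQ (S , QS , RS , PS)
cyclic-not-dominated PQ@(_ , _ , inj₂ _) QR@(_ , _ , inj₂ _) (consecutive p q) (S , PS , QS , RS) =
  consecutive-not-dominated p q PQ QR (S , RS , PS , QS)
cyclic-not-dominated (_ , _ , inj₂ x) (_ , _ , inj₂ y) (_ , _ , inj₂ z) _ =
  ℕ.<-irrefl refl (ℕ.<-trans (decreasing x) (ℕ.<-trans (decreasing z) (decreasing y)))
  where
  decreasing : ∀ {n} {a b c d : Fin n} → (a ≡ c × d < b) ⊎ (b ≡ d × c < a) →
               weight (c , d) ℕ.< weight (a , b)
  decreasing {a = a} (inj₁ (refl , d<b)) = ℕ.+-monoʳ-< (toℕ a) d<b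
  decreasing {b = b} (inj₂ (refl , c<a)) = ℕ.+-monoˡ-< (toℕ b) c<a

-- Adjacency and claws

Adjacent : ∀ {n} → Pair n → Pair n → Set
Adjacent P Q = (P ⟶ Q) ⊎ (Q ⟶ P)

_∈ᵉ_ : ∀ {n} → Fin n → Pair n → Set
x ∈ᵉ (a , b) = x ≡ a ⊎ x ≡ b

Proper : ∀ {n} → Pair n → Set
Proper (a , b) = a < b

adjacent-proper : ∀ {n} {P Q : Pair n} → Adjacent P Q → Proper Q
adjacent-proper (inj₁ (_ , q , _)) = q
adjacent-proper (inj₂ (q , _ , _)) = q

adjacent-common : ∀ {n} {a b : Fin n} {Q : Pair n} → Adjacent (a , b) Q → a ∈ᵉ Q ⊎ b ∈ᵉ Q
adjacent-common (inj₁ (consecutive _ _))   = inj₂ (inj₁ refl)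
adjacent-common (inj₁ (sameLower _ _ _))   = inj₁ (inj₁ refl)
adjacent-common (inj₁ (sameUpper _ _ _))   = inj₂ (inj₂ refl)
adjacent-common (inj₂ (consecutive _ _))   = inj₁ (inj₂ refl)
adjacent-common (inj₂ (sameLower _ _ _))   = inj₁ (inj₁ refl)
adjacent-common (inj₂ (sameUpper _ _ _))   = inj₂ (inj₂ refl)

-- If `x` is the lower end of both pairs, or the upper end of both, then their other ends differ and
-- comparing them gives the arc. Otherwise the pairs are consecutive at `x`.
common-adjacent : ∀ {n} {x : Fin n} {P Q : Pair n} → Proper P → Proper Q → P ≢ Q →
                  x ∈ᵉ P → x ∈ᵉ Q → Adjacent P Q
common-adjacent {P = _ , b} {_ , d} p q P≢Q (inj₁ refl) (inj₁ refl) with <-cmp b d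
... | tri< b<d _ _  = inj₂ (sameLower q p b<d)
... | tri≈ _ refl _ = contradiction refl P≢Q
... | tri> _ _ d<b  = inj₁ (sameLower p q d<b)
common-adjacent p q P≢Q (inj₁ refl) (inj₂ refl) = inj₂ (consecutive q p)
common-adjacent p q P≢Q (inj₂ refl) (inj₁ refl) = inj₁ (consecutive p q)
common-adjacent {P = a , _} {c , _} p q P≢Q (inj₂ refl) (inj₂ refl) with <-cmp a c
... | tri< a<c _ _  = inj₂ (sameUpper q p a<c)
... | tri≈ _ refl _ = contradiction refl P≢Q
... | tri> _ _ c<a  = inj₁ (sameUpper p q c<a)

-- Each leaf contains `a` or `b`, so two of the three leaves contain the same one and are adjacent.
claw-free : ∀ {n} (O : Pair n) (L : Fin 3 → Pair n) → (∀ i → Adjacent O (L i)) →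
            (∀ {i j} → i ≢ j → L i ≢ L j) → (∀ i j → ¬ Adjacent (L i) (L j)) → ⊥
claw-free (a , b) L adj distinct independent =
  pigeonhole (adjacent-common (adj 0F)) (adjacent-common (adj 1F)) (adjacent-common (adj 2F))
  where
  meet : ∀ {x i j} → i ≢ j → x ∈ᵉ L i → x ∈ᵉ L j → ⊥
  meet {i = i} {j} i≢j x∈Lᵢ x∈Lⱼ = independent i j
    (common-adjacent (adjacent-proper (adj i)) (adjacent-proper (adj j)) (distinct i≢j) x∈Lᵢ x∈Lⱼ)

  pigeonhole : a ∈ᵉ L 0F ⊎ b ∈ᵉ L 0F → a ∈ᵉ L 1F ⊎ b ∈ᵉ L 1F → a ∈ᵉ L 2F ⊎ b ∈ᵉ L 2F → ⊥
  pigeonhole (inj₁ x) (inj₁ y) _        = meet (λ ()) x y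
  pigeonhole (inj₂ x) (inj₂ y) _        = meet (λ ()) x y
  pigeonhole (inj₁ x) (inj₂ _) (inj₁ z) = meet (λ ()) x z
  pigeonhole (inj₁ _) (inj₂ y) (inj₂ z) = meet (λ ()) y z
  pigeonhole (inj₂ _) (inj₁ y) (inj₁ z) = meet (λ ()) y z
  pigeonhole (inj₂ x) (inj₁ _) (inj₂ z) = meet (λ ()) x z

-- The line graph as a digraph

does-true : ∀ {A : Set} (A? : Dec A) → does A? ≡ true → A
does-true (yes a) _ = a

pair : ∀ n → Fin (n * n) → Pair n
pair n = remQuot n

pair-injective : ∀ n → Injective _≡_ _≡_ (pair n)
pair-injective n {u} {v} eq =
  trans (sym (combine-remQuot {n} n u))
        (trans (cong (uncurry combine) eq) (combine-remQuot {n} n v))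

-- A pair (a , b) that does not satisfy a < b encodes an isolated vertex.
lineGraph : ℕ → Digraph
lineGraph n = record
  { n        = n * n
  ; arc      = λ u v → does (pair n u ⟶? pair n v)
  ; loopless = λ v → dec-false (pair n v ⟶? pair n v) (λ vv → ⟶-asym vv vv)
  ; antisym  = λ u v uv → dec-false (pair n v ⟶? pair n u)
                 (⟶-asym (does-true (pair n u ⟶? pair n v) uv))
  }

arc⇒⟶ : ∀ n {u v} → arc (lineGraph n) u v ≡ true → pair n u ⟶ pair n v
arc⇒⟶ n {u = u} {v} = does-true (pair n u ⟶? pair n v)

⟶⇒arc : ∀ n {u v} → pair n u ⟶ pair n v → arc (lineGraph n) u v ≡ true
⟶⇒arc n {u = u} {v} = dec-true (pair n u ⟶? pair n v)

-- Subgraphs, rather than induced ones, are excluded because `H` is only assumed to contain `IT` as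
-- a subgraph.
lineGraph-IT-free : ∀ n → ¬ SubgraphIn IT (lineGraph n)
lineGraph-IT-free n (f , _ , preserves) =
  cyclic-not-dominated (step 0F 1F refl) (step 1F 2F refl) (step 2F 0F refl)
    (pair n (f 3F) , step 0F 3F refl , step 1F 3F refl , step 2F 3F refl)
  where
  step : ∀ u v → itArc u v ≡ true → pair n (f u) ⟶ pair n (f v)
  step u v uv = arc⇒⟶ n (preserves u v uv)

lineGraph-star-free : ∀ n t → 3 ≤ t → (dir : Fin t → Bool) →
                      ¬ InducedIn (OrientedStar t dir) (lineGraph n)
lineGraph-star-free n t 3≤t dir (f , f-injective , induced) =
  claw-free (pair n (f zero)) (pair n ∘ f ∘ leaf) adjacent distinct independent
  where
  leaf : Fin 3 → Fin (suc t)
  -- The first three leaves give a claw, whatever their directions.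
  leaf i = suc (inject≤ i 3≤t)

  adjacent : ∀ i → Adjacent (pair n (f zero)) (pair n (f (leaf i)))
  adjacent i with dir (inject≤ i 3≤t) in eq
  ... | true  = inj₁ (arc⇒⟶ n (trans (induced zero (leaf i)) eq))
  ... | false = inj₂ (arc⇒⟶ n (trans (induced (leaf i) zero) (cong not eq)))

  distinct : ∀ {i j} → i ≢ j → pair n (f (leaf i)) ≢ pair n (f (leaf j))
  distinct i≢j eq =
    i≢j (inject≤-injective 3≤t 3≤t _ _ (suc-injective (f-injective (pair-injective n eq))))

  no-arc : ∀ i j → ¬ pair n (f (leaf i)) ⟶ pair n (f (leaf j))
  no-arc i j ij with trans (sym (⟶⇒arc n ij)) (induced (leaf i) (leaf j))
  ... | ()

  independent : ∀ i j → ¬ Adjacent (pair n (f (leaf i))) (pair n (f (leaf j)))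
  independent i j = [ no-arc i j , no-arc j i ]′

-- Dichromatic number

-- The triangle is a directed cycle with `m` = 2; its vertices are distinct because each two are
-- joined by an arc and `D` is loopless.
acyclic-no-cyclic-triangle : ∀ {D S} → Acyclic D S → ∀ {u v w} → S u → S v → S w →
  arc D u v ≡ true → arc D v w ≡ true → ¬ arc D w u ≡ true
acyclic-no-cyclic-triangle {D} {S} acyclic {u} {v} {w} Su Sv Sw uv vw wu =
  acyclic 2 (s≤s z≤n) f (λ {i} {j} → f-injective i j) Sf path wu
  where
  f : Fin 3 → Fin (n D)
  f 0F = u
  f 1F = v
  f 2F = w

  no-loop : ∀ {x y} → arc D x y ≡ true → x ≢ y
  no-loop {x} xy refl with trans (sym xy) (loopless D x)
  ... | ()

  f-injective : ∀ i j → f i ≡ f j → i ≡ j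
  f-injective 0F 0F _ = refl
  f-injective 0F 1F e = contradiction e (no-loop uv)
  f-injective 0F 2F e = contradiction (sym e) (no-loop wu)
  f-injective 1F 0F e = contradiction (sym e) (no-loop uv)
  f-injective 1F 1F _ = refl
  f-injective 1F 2F e = contradiction e (no-loop vw)
  f-injective 2F 0F e = contradiction e (no-loop wu)
  f-injective 2F 1F e = contradiction (sym e) (no-loop vw)
  f-injective 2F 2F _ = refl

  Sf : ∀ i → S (f i)
  Sf 0F = Su
  Sf 1F = Sv
  Sf 2F = Sw

  path : ∀ (i : Fin 2) → arc D (f (inject₁ i)) (f (suc i)) ≡ true
  path 0F = uv
  path 1F = vw

lineGraph-dichromatic-unbounded : ∀ k → ∃ λ n → ¬ DichromaticAtMost (lineGraph n) k
lineGraph-dichromatic-unbounded k with ramsey k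
... | n , impossible = n , λ (c , acyclic) → impossible (λ {i} {j} _ → c (combine i j))
  λ {i} {j} {l} p q r e₁ e₂ →
    let (ij⟶jl , jl⟶il , il⟶ij) = ⟶-cyclic p q
    -- The class is named by the colour of jl, which `e₁` and `e₂` each compare with one other side.
    in acyclic-no-cyclic-triangle {lineGraph n} {λ v → c v ≡ c (combine j l)}
         (acyclic (c (combine j l))) e₁ refl (sym e₂)
         (combined ij⟶jl) (combined jl⟶il) (combined il⟶ij)
  where
  combined : ∀ {a b c d} → (a , b) ⟶ (c , d) →
             arc (lineGraph n) (combine a b) (combine c d) ≡ true
  combined {a} {b} {c} {d} PQ =
    ⟶⇒arc n (subst₂ _⟶_ (sym (remQuot-combine a b)) (sym (remQuot-combine c d)) PQ)

SubgraphIn-InducedIn-trans : ∀ {F H D} → SubgraphIn F H → InducedIn H D → SubgraphIn F D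
SubgraphIn-InducedIn-trans (f , f-inj , f-arc) (g , g-inj , g-arc) =
  g ∘ f , f-inj ∘ g-inj , λ u v uv → trans (g-arc (f u) (f v)) (f-arc u v uv)

theorem2p4 : (t : ℕ) → 4 ≤ t → (dir : Fin t → Bool) → (H : Digraph) →
    ChiFinite₂ H (OrientedStar t dir) → ¬ SubgraphIn IT H
theorem2p4 t 4≤t dir H (k , bounded) IT⊆H with lineGraph-dichromatic-unbounded k
-- The line graph is chosen after the bound `k`, so that it has no partition into `k` acyclic sets.
... | n , unbounded = unbounded (bounded (lineGraph n)
  (λ H⊆D → lineGraph-IT-free n (SubgraphIn-InducedIn-trans {IT} {H} {lineGraph n} IT⊆H H⊆D))
  (lineGraph-star-free n t (ℕ.<⇒≤ 4≤t) dir))
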